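{- For any finite $t\in\mathbb N$ (with $\mathbb N$ the nonnegative integers), the Lowest-Cost-Path algorithm (LCP), with any deterministic tie-breaking rule fixed in advance, has a competitive ratio of $\dfrac{2\cdot 2^t-1}{3\cdot 2^t-1}$ in $\mathrm{OMP}_3(1,t)$: for every instance $(G,\pi)$, the final matching $M$ produced by LCP satisfies $|M|\ge \frac{2\cdot 2^t-1}{3\cdot 2^t-1}\,\nu(G)$.
   Context: Online bipartite matching: an instance $(G,\pi)$ is a finite bipartite graph $G=(L,R,E)$ and an arrival order $\pi$ of $R$. The offline side $L$ is known in advance; online vertices $j\in R$ arrive one by one in order $\pi$, and upon arrival of $j$ all edges incident to $j$ are revealed. The algorithm maintains a matching $M$, initially empty. A vertex is free if it is currently unmatched. $\nu(G)$ is the maximum size of a matching in $G$. $\mathrm{OMP}_3(s,t)$ for $s,t\in\mathbb N\cup\{\infty\}$: upon arrival of $j$, the algorithm either leaves $j$ unmatched (forever, unless matched at this moment) or augments the current matching along an augmenting path of length $1$ or $3$ that starts at $j$ and ends at a free vertex of $L$. A length-1 path $[j~i]$ adds $ji$ with $i\in L$ free. A length-3 path $[j~x~y~i]$, with $x,i\in L$, $y\in R$, $xy\in M$, $i$ free, $jx,yi\in E$, replaces $M$ by $(M\setminus\{xy\})\cup\{jx,yi\}$; then $x$ and $y$ are each said to be reassigned once (they are matched before and after, to different neighbors). Over the execution, each vertex of $L$ may be reassigned at most $s$ times and each vertex of $R$ at most $t$ times. A vertex is exhausted once it has reached its budget; an augmentation is feasible if every vertex it would reassign is not exhausted before it. LCP: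 upon arrival of $j$, assign to each feasible augmenting path starting at $j$ a cost: a length-1 path has cost $-1$; a length-3 path $[j~x~y~i]$ has cost equal to the number of times $y$ has been reassigned before this move. If some feasible path of length 1 or 3 exists, augment along one of minimum cost (ties broken by an arbitrary fixed deterministic rule); otherwise leave $j$ unmatched. -}

module Defs where

open import Data.Fin.Base using (Fin)
import Data.Fin.Base as Fin
import Data.Fin.Properties as Fin
open import Data.Fin.Permutation using (Permutation′; _⟨$⟩ʳ_)
open import Data.Fin.Subset using (Subset)
import Data.Fin.Subset as Subset
import Data.Fin.Subset.Properties as Subset
import Data.Integer.Base as ℤ
import Data.Integer.Properties as ℤ
open import Data.List.Base using (List; []; _∷_; _++_; map; filter; foldl; length; lookup; allFin; cartesianProduct)
open import Data.List.NonEmpty.Base as List⁺ using (List⁺; _∷_)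
open import Data.List.Membership.Propositional using (_∈_)
open import Data.List.Membership.Propositional.Properties using (∈-lookup)
import Data.List.Membership.DecPropositional as DecMembership
open import Data.List.Properties using (length-map)
open import Data.List.Relation.Unary.All using (All; all?)
import Data.List.Relation.Unary.All as All
open import Data.List.Relation.Unary.AllPairs using ([]; _∷_)
open import Data.List.Relation.Unary.Unique.Propositional using (Unique)
import Data.List.Relation.Unary.Unique.DecPropositional as DecUnique
open import Data.Nat.Base using (ℕ; zero; suc; _*_; _∸_; _^_; _≤_; z≤n; s≤s; NonZero; >-nonZero; s≤s⁻¹)
import Data.Nat.Properties as ℕ
open import Data.Product.Base using (∃; _×_; _,_; proj₁; proj₂)
open import Data.Product.Properties using (≡-dec)
open import Data.Rational.Base using (ℚ; _/_)
open import Data.Unit.Base using (⊤; tt)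
open import Data.Vec.Functional using (Vector; updateAt; replicate)
open import Relation.Binary.Definitions using (DecidableEquality)
open import Relation.Binary.PropositionalEquality using (_≡_; refl; sym; cong; subst)
open import Relation.Nullary using (¬_; Dec; yes; no; contradiction)
open import Relation.Nullary.Decidable using (_×-dec_; ¬?; map′)
open import Relation.Unary using (Decidable)

-- L = Fin m and R = Fin n.
record BipartiteGraph (m n : ℕ) : Set where
  field
    neighbours : Fin n → Subset m

open BipartiteGraph public

Adj : ∀ {m n} → BipartiteGraph m n → Fin m → Fin n → Set
Adj G i j = i Subset.∈ neighbours G j

adj? : ∀ {m n} (G : BipartiteGraph m n) i j → Dec (Adj G i j)
adj? G i j = i Subset.∈? neighbours G j

EdgeList : ℕ → ℕ → Set
EdgeList m n = List (Fin m × Fin n)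

_≟ₑ_ : ∀ {m n} → DecidableEquality (Fin m × Fin n)
_≟ₑ_ = ≡-dec Fin._≟_ Fin._≟_

record IsMatching {m n} (G : BipartiteGraph m n) (M : EdgeList m n) : Set where
  constructor isMatching
  field
    edges     : All (λ (i , j) → Adj G i j) M
    distinctL : Unique (map proj₁ M)
    distinctR : Unique (map proj₂ M)

record IsMatchingNumber {m n} (G : BipartiteGraph m n) (k : ℕ) : Set where
  field
    attained : ∃ λ M → IsMatching G M × length M ≡ k
    maximal  : ∀ {M} → IsMatching G M → length M ≤ k

private

  isMatching? : ∀ {m n} (G : BipartiteGraph m n) → Decidable (IsMatching G)
  isMatching? G M =
    map′ (λ (e , l , r) → isMatching e l r)
         (λ (isMatching e l r) → e , l , r)
         (all? (λ (i , j) → adj? G i j) M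
           ×-dec DecUnique.unique? Fin._≟_ (map proj₁ M)
           ×-dec DecUnique.unique? Fin._≟_ (map proj₂ M))

  unique-lookup : ∀ {A : Set} {xs : List A} → Unique xs →
                  ∀ {i j} → lookup xs i ≡ lookup xs j → i ≡ j
  unique-lookup (_  ∷ _) {Fin.zero}  {Fin.zero}  _  = refl
  unique-lookup (x≢ ∷ _) {Fin.zero}  {Fin.suc j} eq =
    contradiction eq (All.lookup x≢ (∈-lookup j))
  unique-lookup (x≢ ∷ _) {Fin.suc i} {Fin.zero}  eq =
    contradiction (sym eq) (All.lookup x≢ (∈-lookup i))
  unique-lookup (_  ∷ u) {Fin.suc _} {Fin.suc _} eq =
    cong Fin.suc (unique-lookup u eq)

  length≤m : ∀ {m n} (G : BipartiteGraph m n) {M} → IsMatching G M → length M ≤ m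
  length≤m G {M} (isMatching _ l _) =
    subst (_≤ _) (length-map proj₁ M) (Fin.injective⇒≤ (unique-lookup l))

  ofLength? : ∀ {m n} k {P : EdgeList m n → Set} → Decidable P →
              Dec (∃ λ M → P M × length M ≡ k)
  ofLength? zero P? =
    map′ (λ p → [] , p , refl) (λ { ([] , p , _) → p }) (P? [])
  ofLength? (suc k) P? =
    map′ (λ (i , j , M , p , eq) → (i , j) ∷ M , p , cong suc eq)
         (λ { ((i , j) ∷ M , p , eq) → i , j , M , p , ℕ.suc-injective eq })
         (Fin.any? λ i → Fin.any? λ j → ofLength? k λ M → P? ((i , j) ∷ M))

  search : ∀ {m n} (G : BipartiteGraph m n) k →
           (∀ {M} → IsMatching G M → length M ≤ k) → ∃ (IsMatchingNumber G)
  search G k bound with ofLength? k (isMatching? G)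
  ... | yes found = k , record { attained = found ; maximal = bound }
  search G zero    bound | no none =
    contradiction ([] , isMatching All.[] [] [] , refl) none
  search G (suc k) bound | no none =
    search G k λ {M} mM → s≤s⁻¹ (ℕ.≤∧≢⇒< (bound mM) λ eq → none (M , mM , eq))

matchingNumber : ∀ {m n} (G : BipartiteGraph m n) → ∃ (IsMatchingNumber G)
matchingNumber {m} G = search G m (length≤m G)

ν : ∀ {m n} → BipartiteGraph m n → ℕ
ν G = proj₁ (matchingNumber G)

-- reassignedL and reassignedR count past reassignments; arrived lists the
-- online vertices seen so far, in order of arrival.
record State (m n : ℕ) : Set where
  field
    matching    : EdgeList m n
    reassignedL : Vector ℕ m
    reassignedR : Vector ℕ n
    arrived     : List (Fin n)

open State public

initial : ∀ {m n} → State m n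
initial = record
  { matching    = []
  ; reassignedL = replicate _ 0
  ; reassignedR = replicate _ 0
  ; arrived     = []
  }

FreeL : ∀ {m n} → EdgeList m n → Fin m → Set
FreeL M i = ¬ (i ∈ map proj₁ M)

-- A path of length 1 or 3 starting at j: [ j i ] or [ j x y i ].
data Path {m n} (j : Fin n) : Set where
  direct : (i : Fin m) → Path j
  via    : (x : Fin m) (y : Fin n) (i : Fin m) → Path j

allPaths : ∀ {m n} (j : Fin n) → List (Path {m} j)
allPaths {m} {n} j =
  map direct (allFin m) ++
  map (λ (x , y , i) → via x y i)
      (cartesianProduct (allFin m) (cartesianProduct (allFin n) (allFin m)))

-- The start j is an arriving vertex and hence unmatched.
Augmenting : ∀ {m n} → BipartiteGraph m n → EdgeList m n → {j : Fin n} → Path {m} j → Set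
Augmenting G M {j} (direct i)  = Adj G i j × FreeL M i
Augmenting G M {j} (via x y i) = Adj G x j × (x , y) ∈ M × Adj G i y × FreeL M i

ExhaustedL : ∀ {m n} → ℕ → State m n → Fin m → Set
ExhaustedL s σ x = s ≤ reassignedL σ x

ExhaustedR : ∀ {m n} → ℕ → State m n → Fin n → Set
ExhaustedR t σ y = t ≤ reassignedR σ y

WithinBudget : ∀ {m n} (s t : ℕ) → State m n → {j : Fin n} → Path {m} j → Set
WithinBudget s t σ (direct i)  = ⊤
WithinBudget s t σ (via x y i) = ¬ ExhaustedL s σ x × ¬ ExhaustedR t σ y

Feasible : ∀ {m n} (s t : ℕ) → BipartiteGraph m n → State m n → {j : Fin n} → Path {m} j → Set
Feasible s t G σ p = Augmenting G (matching σ) p × WithinBudget s t σ p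

freeL? : ∀ {m n} (M : EdgeList m n) → Decidable (FreeL M)
freeL? M i = ¬? (DecMembership._∈?_ Fin._≟_ i (map proj₁ M))

augmenting? : ∀ {m n} (G : BipartiteGraph m n) M {j : Fin n} → Decidable (Augmenting G M {j})
augmenting? G M {j} (direct i)  = adj? G i j ×-dec freeL? M i
augmenting? G M {j} (via x y i) =
  adj? G x j ×-dec DecMembership._∈?_ _≟ₑ_ (x , y) M ×-dec adj? G i y ×-dec freeL? M i

withinBudget? : ∀ {m n} (s t : ℕ) (σ : State m n) {j : Fin n} → Decidable (WithinBudget s t σ {j})
withinBudget? s t σ (direct i)  = yes tt
withinBudget? s t σ (via x y i) =
  ¬? (s ℕ.≤? reassignedL σ x) ×-dec ¬? (t ℕ.≤? reassignedR σ y)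

feasible? : ∀ {m n} (s t : ℕ) (G : BipartiteGraph m n) (σ : State m n) {j : Fin n} →
            Decidable (Feasible s t G σ {j})
feasible? s t G σ p = augmenting? G (matching σ) p ×-dec withinBudget? s t σ p

augment : ∀ {m n} → State m n → {j : Fin n} → Path {m} j → State m n
augment σ {j} (direct i)  = record σ { matching = (i , j) ∷ matching σ }
augment σ {j} (via x y i) = record σ
  { matching    = (x , j) ∷ (i , y) ∷ filter (λ e → ¬? (e ≟ₑ (x , y))) (matching σ)
  ; reassignedL = updateAt (reassignedL σ) x suc
  ; reassignedR = updateAt (reassignedR σ) y suc
  }

cost : ∀ {m n} → State m n → {j : Fin n} → Path {m} j → ℤ.ℤ
cost σ (direct i)  = ℤ.-1ℤ
cost σ (via x y i) = ℤ.+ reassignedR σ y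

feasiblePaths : ∀ {m n} (s t : ℕ) → BipartiteGraph m n → State m n → (j : Fin n) → List (Path {m} j)
feasiblePaths s t G σ j = filter (feasible? s t G σ) (allPaths j)

cheapestPaths : ∀ {m n} (s t : ℕ) → BipartiteGraph m n → State m n → (j : Fin n) → List (Path {m} j)
cheapestPaths s t G σ j = filter (λ p → all? (λ q → cost σ p ℤ.≤? cost σ q) ps) ps
  where ps = feasiblePaths s t G σ j

-- The arrived online vertices in order of arrival, with their neighbourhoods.
Revealed : ℕ → ℕ → Set
Revealed m n = List (Fin n × Subset m)

revealed : ∀ {m n} → BipartiteGraph m n → State m n → Revealed m n
revealed G σ = map (λ j → j , neighbours G j) (arrived σ)

-- A deterministic tie-breaking rule may depend on everything known to the
-- online algorithm, but not on vertices that are yet to arrive.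
TieBreak : Set
TieBreak = ∀ {m n} → Revealed m n → State m n → (j : Fin n) (ps : List⁺ (Path {m} j)) →
           ∃ λ p → p ∈ List⁺.toList ps

arrive : ∀ {m n} → State m n → Fin n → State m n
arrive σ j = record σ { arrived = arrived σ ++ j ∷ [] }

module _ (s t : ℕ) (rule : TieBreak) {m n} (G : BipartiteGraph m n) where

  choose : State m n → (j : Fin n) → List (Path {m} j) → State m n
  choose σ j []       = σ
  choose σ j (p ∷ ps) = augment σ (proj₁ (rule (revealed G σ) σ j (p ∷ ps)))

  step : State m n → Fin n → State m n
  step σ j = choose (arrive σ j) j (cheapestPaths s t G (arrive σ j) j)

  -- π sends each arrival time to the vertex arriving then.
  lcp : Permutation′ n → EdgeList m n
  lcp π = matching (foldl step initial (map (π ⟨$⟩ʳ_) (allFin n)))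

-- Both truncated subtractions are exact, since 2 ^ t ≥ 1.
ratio : ℕ → ℚ
ratio t = (ℤ.+ (2 * 2 ^ t ∸ 1)) / (3 * 2 ^ t ∸ 1)
  where
  instance
    nonZero : NonZero (3 * 2 ^ t ∸ 1)
    nonZero = >-nonZero (ℕ.m<n⇒0<n∸m
      (ℕ.≤-trans (s≤s (s≤s z≤n)) (ℕ.*-monoʳ-≤ 3 (ℕ.m^n>0 2 t))))

fromℕ : ℕ → ℚ
fromℕ k = ℤ.+ k / 1

{-# OPTIONS --safe #-}

-- Linear-programming duality. Put T = 2ᵗ, let r d be the number of reassignments of d ∈ R, and call d good
-- while it has a free neighbour. Give each v ∈ R a label c v: T as long as v is unmatched, 0 if v was matched
-- directly on arrival, and 2ᵏ if v was matched by a path of cost k. A path of cost k raises 2^(r y) by exactly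
-- the label 2ᵏ it creates, so over the matched vertices Σ (2^(r d) − 1) ≤ Σ c d at all times. A good vertex was
-- matched directly, and its partner was never reassigned; so the choice of a cheapest path, or the absence of a
-- feasible one, yields c v ≤ 2^(r d) whenever an arrived v is adjacent to the partner of a good d.
-- At the end, give a matched edge (u , d) the dual values T − 1 + 2^(r d) at u and 2T − 1 at d if d is good, and
-- 2T − 1 at u and T − c d at d otherwise. Every edge of G then receives at least 2T − 1, while the total is at
-- most (3T − 1) |M| by the inequality between the sums.

module Submission where

open import Defs
open import Data.Bool.Base using (if_then_else_)
open import Data.Fin.Base using (Fin)
import Data.Fin.Properties as Fin
open import Data.Fin.Permutation using (Permutation′; _⟨$⟩ʳ_; _⟨$⟩ˡ_; inverseʳ)
import Data.Integer.Base as ℤ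
import Data.Integer.Properties as ℤ
open import Data.List.Base using (List; []; _∷_; _++_; map; filter; foldl; length; allFin)
import Data.List.Extrema ℤ.≤-totalOrder as Extrema
import Data.List.Membership.DecPropositional as DecMembership
open import Data.List.Membership.Propositional using (_∈_; _∉_)
open import Data.List.Membership.Propositional.Properties
import Data.List.NonEmpty.Base as List⁺
open import Data.List.Properties using (filter-all; filter-accept; filter-reject; map-∘; ++-identityʳ; ++-assoc)
open import Data.List.Relation.Binary.Permutation.Propositional
  using (_↭_; ↭-refl; ↭-trans; ↭-sym; ↭-prep; ↭-swap; ↭⇒↭ₛ)
import Data.List.Relation.Binary.Permutation.Propositional.Properties as ↭
import Data.List.Relation.Binary.Permutation.Setoid.Properties as ↭ₛ
open import Data.List.Relation.Unary.All using (All; []; _∷_; all?)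
import Data.List.Relation.Unary.All as All
open import Data.List.Relation.Unary.All.Properties.Core using (¬Any⇒All¬; All¬⇒¬Any)
open import Data.List.Relation.Unary.AllPairs using ([]; _∷_)
open import Data.List.Relation.Unary.Any using (here; there)
open import Data.List.Relation.Unary.Unique.Propositional using (Unique)
import Data.List.Relation.Unary.Unique.Propositional.Properties as Unique
open import Data.Nat.Base using (ℕ; suc; pred; _+_; _∸_; _^_; _≤_; _<_; z≤n; s≤s; NonZero)
import Data.Nat.Base as ℕ
open import Data.Nat.ListAction using (sum)
open import Data.Nat.ListAction.Properties using (sum-↭)
open import Data.Nat.Properties
open import Data.Nat.Tactic.RingSolver using (solve-∀)
open import Data.Product.Base using (∃; _×_; _,_; proj₁; proj₂)
open import Data.Rational.Base using (_≥_; _*_)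
import Data.Rational.Base as ℚ
import Data.Rational.Properties as ℚ
import Data.Rational.Unnormalised.Base as ℚᵘ
import Data.Rational.Unnormalised.Properties as ℚᵘ
open import Data.Sum.Base using (_⊎_; inj₁; inj₂)
open import Data.Unit.Base using (tt)
open import Data.Vec.Functional using (Vector; updateAt)
open import Data.Vec.Functional.Properties using (updateAt-updates; updateAt-minimal)
open import Function.Base using (_∘_; const)
open import Function.Bundles using (Injection)
open import Function.Properties.Inverse using (↔⇒↣)
open import Relation.Binary.Definitions using (DecidableEquality)
open import Relation.Binary.PropositionalEquality
open import Relation.Nullary using (¬_; Dec; yes; no; contradiction)
open import Relation.Nullary.Decidable using (does; _×-dec_; ¬?)

private
  variable
    A B : Set

-- Sums over lists.

total : (A → ℕ) → List A → ℕ
total f xs = sum (map f xs)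

total-↭ : ∀ (f : A → ℕ) {xs ys} → xs ↭ ys → total f xs ≡ total f ys
total-↭ f p = sum-↭ (↭.map⁺ f p)

total-+ : ∀ (f g : A → ℕ) xs → total (λ x → f x + g x) xs ≡ total f xs + total g xs
total-+ f g []       = refl
total-+ f g (x ∷ xs) = trans (cong (f x + g x +_) (total-+ f g xs)) (swap (f x) (g x) _ _)
  where
  swap : ∀ a b c d → a + b + (c + d) ≡ a + c + (b + d)
  swap = solve-∀

total-const : ∀ k (xs : List A) → total (λ _ → k) xs ≡ length xs ℕ.* k
total-const k []       = refl
total-const k (x ∷ xs) = cong (k +_) (total-const k xs)

total-mono : ∀ {f g : A → ℕ} xs → (∀ {x} → x ∈ xs → f x ≤ g x) → total f xs ≤ total g xs
total-mono []       le = z≤n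
total-mono (x ∷ xs) le = +-mono-≤ (le (here refl)) (total-mono xs (le ∘ there))

total-updateAt : ∀ {n} (f : A → ℕ) (v : Vector A n) {j u} {ks : List (Fin n)} → j ∉ ks →
                 total (f ∘ updateAt v j u) ks ≡ total (f ∘ v) ks
total-updateAt f v {ks = []}     j∉ = refl
total-updateAt f v {j} {ks = k ∷ ks} j∉ =
  cong₂ _+_ (cong f (updateAt-minimal k j v (λ { refl → j∉ (here refl) })))
            (total-updateAt f v (j∉ ∘ there))

-- Charging the weights of edges to their endpoints.

module Charging (_≟_ : DecidableEquality A) (key : B → A) (w : B → ℕ) where

  -- With the edges of the matching as `bs` and an endpoint as `key`, this is the dual value of the
  -- vertex `a`; an unmatched vertex gets 0.
  charge : List B → A → ℕ
  charge bs a = total (λ b → if does (key b ≟ a) then w b else 0) bs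

  charge-≥ : ∀ {b bs} → b ∈ bs → w b ≤ charge bs (key b)
  charge-≥ {b} (here refl) with key b ≟ key b
  ... | yes _   = m≤m+n _ _
  ... | no  b≢b = contradiction refl b≢b
  charge-≥ (there b∈bs) = m≤n⇒m≤o+n _ (charge-≥ b∈bs)

  private
    charge-∉ : ∀ b {as} → All (key b ≢_) as → total (λ a → if does (key b ≟ a) then w b else 0) as ≡ 0
    charge-∉ b [] = refl
    charge-∉ b {a ∷ _} (b≢a ∷ b∉) with key b ≟ a
    ... | yes b≡a = contradiction b≡a b≢a
    ... | no  _   = charge-∉ b b∉

    charge-single : ∀ b {as} → Unique as → total (λ a → if does (key b ≟ a) then w b else 0) as ≤ w b
    charge-single b [] = z≤n
    charge-single b {a ∷ _} (a∉ ∷ u) with key b ≟ a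
    ... | yes refl = ≤-reflexive (trans (cong (w b +_) (charge-∉ b a∉)) (+-identityʳ _))
    ... | no  _    = charge-single b u

  -- Exchange the order of summation: `as` has no duplicates, so each weight is counted for at most
  -- one vertex. Keys absent from `as` make this an inequality.
  total-charge : ∀ bs {as} → Unique as → total (charge bs) as ≤ total w bs
  total-charge []       {as} u = ≤-reflexive (trans (total-const 0 as) (*-zeroʳ (length as)))
  total-charge (b ∷ bs) {as} u = begin
    total (charge (b ∷ bs)) as     ≡⟨ total-+ _ (charge bs) as ⟩
    _ + total (charge bs) as       ≤⟨ +-mono-≤ (charge-single b u) (total-charge bs u) ⟩
    w b + total w bs               ∎
    where open ≤-Reasoning

-- Duplicate-free lists and permutations.

Unique-resp-↭ : ∀ {xs ys : List A} → xs ↭ ys → Unique xs → Unique ys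
Unique-resp-↭ p = ↭ₛ.Unique-resp-↭ (setoid _) (↭⇒↭ₛ p)

head∉ : ∀ {x : A} {xs} → Unique (x ∷ xs) → x ∉ xs
head∉ (x∉ ∷ _) = All¬⇒¬Any x∉

∉-∷ : ∀ {x : A} {xs} → x ∉ xs → Unique xs → Unique (x ∷ xs)
∉-∷ x∉ u = ¬Any⇒All¬ _ x∉ ∷ u

-- Uniqueness ensures that filtering removes exactly one entry. This lets sums over the matching
-- split off the edge that `augment` deletes.
filter-≢-↭ : ∀ (_≟_ : DecidableEquality A) {x xs} → Unique xs → x ∈ xs →
             xs ↭ x ∷ filter (λ y → ¬? (y ≟ x)) xs
filter-≢-↭ _≟_ {x} {xs = _ ∷ xs} (x∉ ∷ _) (here refl)
  rewrite filter-reject (λ y → ¬? (y ≟ x)) {x} {xs} (λ x≢x → x≢x refl)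
        | filter-all (λ y → ¬? (y ≟ x)) (All.map ≢-sym x∉) = ↭-refl
filter-≢-↭ _≟_ {x} {xs = y ∷ xs} (y∉ ∷ u) (there x∈)
  rewrite filter-accept (λ y → ¬? (y ≟ x)) {y} {xs} (All.lookup y∉ x∈) =
  ↭-trans (↭-prep y (filter-≢-↭ _≟_ u x∈)) (↭-swap y x ↭-refl)

-- From natural numbers to rationals.

/-*-≤ : ∀ a d .{{_ : NonZero d}} b c → a ℕ.* b ≤ d ℕ.* c →
        (ℤ.+ a ℚ./ d) ℚ.* (ℤ.+ b ℚ./ 1) ℚ.≤ ℤ.+ c ℚ./ 1
-- Elements of `ℚ` are reduced fractions; the unnormalised form keeps `a` and `d` visible for
-- cross-multiplication.
/-*-≤ a d@(suc _) b c le = ℚ.toℚᵘ-cancel-≤ (begin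
  ℚ.toℚᵘ ((ℤ.+ a ℚ./ d) ℚ.* (ℤ.+ b ℚ./ 1))            ≃⟨ ℚ.toℚᵘ-homo-* (ℤ.+ a ℚ./ d) (ℤ.+ b ℚ./ 1) ⟩
  ℚ.toℚᵘ (ℤ.+ a ℚ./ d) ℚᵘ.* ℚ.toℚᵘ (ℤ.+ b ℚ./ 1)
    ≃⟨ ℚᵘ.*-cong (ℚ.toℚᵘ-fromℚᵘ (ℤ.+ a ℚᵘ./ d)) (ℚ.toℚᵘ-fromℚᵘ (ℤ.+ b ℚᵘ./ 1)) ⟩
  (ℤ.+ a ℚᵘ./ d) ℚᵘ.* (ℤ.+ b ℚᵘ./ 1)                   ≤⟨ ℚᵘ.*≤* (subst₂ ℤ._≤_ lhs rhs (ℤ.+≤+ le)) ⟩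
  ℤ.+ c ℚᵘ./ 1                                         ≃⟨ ℚ.toℚᵘ-fromℚᵘ (ℤ.+ c ℚᵘ./ 1) ⟨
  ℚ.toℚᵘ (ℤ.+ c ℚ./ 1)                                 ∎)
  where
  open ℚᵘ.≤-Reasoning
  lhs : ℤ.+ (a ℕ.* b) ≡ (ℤ.+ a ℤ.* ℤ.+ b) ℤ.* ℤ.1ℤ
  lhs = trans (ℤ.pos-* a b) (sym (ℤ.*-identityʳ _))
  rhs : ℤ.+ (d ℕ.* c) ≡ ℤ.+ c ℤ.* ℤ.+ (d ℕ.* 1)
  rhs = trans (cong ℤ.+_ (trans (*-comm d c) (cong (c ℕ.*_) (sym (*-identityʳ d))))) (ℤ.pos-* c (d ℕ.* 1))

-- One step of LCP.

∈-allPaths : ∀ {m n} {j : Fin n} (p : Path {m} j) → p ∈ allPaths j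
∈-allPaths (direct i)  = ∈-++⁺ˡ (∈-map⁺ direct (∈-allFin i))
∈-allPaths (via x y i) = ∈-++⁺ʳ _ (∈-map⁺ (λ (x , y , i) → via x y i)
  (∈-cartesianProduct⁺ (∈-allFin x) (∈-cartesianProduct⁺ (∈-allFin y) (∈-allFin i))))

module _ (s t : ℕ) {m n} (G : BipartiteGraph m n) (σ : State m n) (j : Fin n) where

  cheapest-≤ : ∀ {p : Path {m} j} → p ∈ cheapestPaths s t G σ j →
               Feasible s t G σ p × (∀ (q : Path {m} j) → Feasible s t G σ q → cost σ p ℤ.≤ cost σ q)
  cheapest-≤ p∈ with ∈-filter⁻ (λ p → all? (λ q → cost σ p ℤ.≤? cost σ q) (feasiblePaths s t G σ j)) p∈
  ... | p∈feasible , p≤ =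
    proj₂ (∈-filter⁻ (feasible? s t G σ) {xs = allPaths j} p∈feasible) ,
    λ q feasible → All.lookup p≤ (∈-filter⁺ (feasible? s t G σ) (∈-allPaths q) feasible)

  cheapest-nonempty : ∀ {p : Path {m} j} → Feasible s t G σ p → ∃ (_∈ cheapestPaths s t G σ j)
  cheapest-nonempty {p} feasible =
    best , ∈-filter⁺ (λ p → all? (λ q → cost σ p ℤ.≤? cost σ q) ps) best∈ (Extrema.f[argmin]≤f[xs] p ps)
    where
    ps = feasiblePaths s t G σ j
    best = Extrema.argmin (cost σ) p ps
    best∈ : best ∈ ps
    best∈ with Extrema.argmin-sel (cost σ) p ps
    -- The default value of `argmin` is `p`, itself feasible, so the minimiser lies in `ps` in
    -- either case.
    ... | inj₁ eq = subst (_∈ ps) (sym eq) (∈-filter⁺ (feasible? s t G σ) (∈-allPaths p) feasible)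
    ... | inj₂ ∈ps = ∈ps

-- Forgets the tie-breaking rule: all that remains of a move is that no path was feasible, or that
-- some feasible path of minimum cost was used. The analysis thereby covers every rule.
data Outcome (s t : ℕ) {m n} (G : BipartiteGraph m n) (σ : State m n) (j : Fin n) : State m n → Set where
  stuck     : (∀ (p : Path {m} j) → ¬ Feasible s t G σ p) → Outcome s t G σ j σ
  augmented : ∀ (p : Path {m} j) → Feasible s t G σ p →
              (∀ (q : Path {m} j) → Feasible s t G σ q → cost σ p ℤ.≤ cost σ q) → Outcome s t G σ j (augment σ p)

step-outcome : ∀ s t (rule : TieBreak) {m n} (G : BipartiteGraph m n) σ j →
               Outcome s t G (arrive σ j) j (step s t rule G σ j)
step-outcome s t rule {m} G σ j =
  choose-outcome (cheapestPaths s t G τ j) (cheapest-≤ s t G τ j) (cheapest-nonempty s t G τ j)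
  where
  τ = arrive σ j
  choose-outcome : ∀ ps →
    (∀ {p : Path {m} j} → p ∈ ps → Feasible s t G τ p ×
      (∀ (q : Path {m} j) → Feasible s t G τ q → cost τ p ℤ.≤ cost τ q)) →
    (∀ {p : Path {m} j} → Feasible s t G τ p → ∃ (_∈ ps)) →
    Outcome s t G τ j (choose s t rule G τ j ps)
  choose-outcome []       _    ne = stuck λ p feasible → contradiction (proj₂ (ne feasible)) λ ()
  choose-outcome (p ∷ ps) best _  with rule (revealed G τ) τ j (p List⁺.∷ ps)
  ... | q , q∈ = augmented q (proj₁ (best q∈)) (proj₂ (best q∈))

-- Good vertices and the invariant.

module _ {m n} (G : BipartiteGraph m n) where

  -- Matched vertices of `L` never become free again, so goodness can only be lost: what is good
  -- after a move was good before it.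
  Good : EdgeList m n → Fin n → Set
  Good M v = ∃ λ i → Adj G i v × FreeL M i

  good? : ∀ M v → Dec (Good M v)
  good? M v = Fin.any? λ i → adj? G i v ×-dec freeL? M i

module Analysis (t : ℕ) {m n} (G : BipartiteGraph m n) where

  T : ℕ
  T = 2 ^ t

  -- The labels `c` are a ghost record outside the algorithm's state; only the entry of an arriving
  -- vertex changes, when it is matched. `good-ℓ` is what makes a budget of one on `L` suffice.
  record Invariant (σ : State m n) (c : Vector ℕ n) : Set where
    private
      M = matching σ
    field
      uniqueL        : Unique (map proj₁ M)
      uniqueR        : Unique (map proj₂ M)
      matched-arrived : ∀ {v} → v ∈ map proj₂ M → v ∈ arrived σ
      unmatched-c    : ∀ {v} → v ∉ map proj₂ M → c v ≡ T
      unmatched-r    : ∀ {v} → v ∉ map proj₂ M → reassignedR σ v ≡ 0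
      c≤T            : ∀ v → c v ≤ T
      free-ℓ         : ∀ {u} → FreeL M u → reassignedL σ u ≡ 0
      good-ℓ         : ∀ {u d} → (u , d) ∈ M → Good G M d → reassignedL σ u ≡ 0
      good-c         : ∀ {v} → v ∈ arrived σ → Good G M v → c v ≡ 0
      c≤2^r          : ∀ {u v d} → v ∈ arrived σ → Adj G u v → (u , d) ∈ M → Good G M d →
                       c v ≤ 2 ^ reassignedR σ d
      -- This is Σ (2^r - 1) ≤ Σ c, with 1 added per matched vertex on both sides to avoid
      -- subtraction.
      balance        : total (λ d → 2 ^ reassignedR σ d) (map proj₂ M) ≤ total (suc ∘ c) (map proj₂ M)

  initial-invariant : Invariant initial (const T)
  initial-invariant = record
    { uniqueL         = []
    ; uniqueR         = []
    ; matched-arrived = λ ()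
    ; unmatched-c     = λ _ → refl
    ; unmatched-r     = λ _ → refl
    ; c≤T             = λ _ → ≤-refl
    ; free-ℓ          = λ _ → refl
    ; good-ℓ          = λ ()
    ; good-c          = λ ()
    ; c≤2^r           = λ ()
    ; balance         = z≤n
    }

  -- Preservation of the invariant by an arrival.

  module _ {σ : State m n} {c : Vector ℕ n} (inv : Invariant σ c) {j : Fin n} (new : j ∉ arrived σ) where

    open Invariant inv

    private
      M = matching σ
      ℓ = reassignedL σ
      r = reassignedR σ
      τ = arrive σ j

      j∉M : j ∉ map proj₂ M
      j∉M = new ∘ matched-arrived

      ∈-arrive : ∀ {v} → v ∈ arrived σ → v ∈ arrived τ
      ∈-arrive = ∈-++⁺ˡ

      arrive-case : ∀ {v} → v ∈ arrived τ → v ∈ arrived σ ⊎ v ≡ j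
      arrive-case v∈ with ∈-++⁻ (arrived σ) v∈
      ... | inj₁ v∈σ        = inj₁ v∈σ
      ... | inj₂ (here v≡j) = inj₂ v≡j

      old≢j : ∀ {v} → v ∈ arrived σ → v ≢ j
      old≢j v∈ refl = new v∈

      -- The partner of a good vertex was never reassigned, so its budget of one is intact and only
      -- the budget of `d` matters.
      good-feasible : ∀ {u d i} → Adj G u j → (u , d) ∈ M → Adj G i d → FreeL M i → r d < t →
                      Feasible 1 t G τ (via {j = j} u d i)
      good-feasible u~j ud∈M i~d free r<t =
        (u~j , ud∈M , i~d , free) ,
        (λ 1≤ℓ → contradiction (good-ℓ ud∈M (_ , i~d , free)) (≢-sym (<⇒≢ 1≤ℓ))) ,
        <⇒≱ r<t

    stuck-invariant : (∀ (p : Path {m} j) → ¬ Feasible 1 t G τ p) → Invariant τ c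
    stuck-invariant infeasible = record
      { uniqueL         = uniqueL
      ; uniqueR         = uniqueR
      ; matched-arrived = ∈-arrive ∘ matched-arrived
      ; unmatched-c     = unmatched-c
      ; unmatched-r     = unmatched-r
      ; c≤T             = c≤T
      ; free-ℓ          = free-ℓ
      ; good-ℓ          = good-ℓ
      ; good-c          = good-c′
      ; c≤2^r           = c≤2^r′
      ; balance         = balance
      }
      where
      good-c′ : ∀ {v} → v ∈ arrived τ → Good G M v → c v ≡ 0
      good-c′ v∈ good with arrive-case v∈
      ... | inj₁ v∈σ = good-c v∈σ good
      good-c′ v∈ (i , i~v , free) | inj₂ refl = contradiction ((i~v , free) , tt) (infeasible (direct i))

      c≤2^r′ : ∀ {u v d} → v ∈ arrived τ → Adj G u v → (u , d) ∈ M → Good G M d → c v ≤ 2 ^ r d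
      c≤2^r′ v∈ u~v ud∈M good with arrive-case v∈
      ... | inj₁ v∈σ = c≤2^r v∈σ u~v ud∈M good
      c≤2^r′ {d = d} v∈ u~v ud∈M (i , i~d , free) | inj₂ refl with t ≤? r d
      -- If `d` is exhausted, 2^(r d) is at least `T` and so bounds every label; otherwise `j` would
      -- have had a feasible path through `d`.
      ... | yes t≤r = ≤-trans (c≤T _) (^-monoʳ-≤ 2 t≤r)
      ... | no  t≰r = contradiction (good-feasible u~v ud∈M i~d free (≰⇒> t≰r)) (infeasible (via _ _ i))

    direct-invariant : ∀ i → Augmenting G M {j} (direct i) →
                       Invariant (augment τ {j} (direct i)) (updateAt c j (const 0))
    direct-invariant i (i~j , free-i) = record
      { uniqueL         = ∉-∷ free-i uniqueL
      ; uniqueR         = ∉-∷ j∉M uniqueR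
      ; matched-arrived = λ { (here refl) → ∈-++⁺ʳ (arrived σ) (here refl)
                            ; (there v∈) → ∈-arrive (matched-arrived v∈) }
      ; unmatched-c     = λ v∉ → trans (c′-old (v∉ ∘ here)) (unmatched-c (v∉ ∘ there))
      ; unmatched-r     = λ v∉ → unmatched-r (v∉ ∘ there)
      ; c≤T             = c≤T′
      ; free-ℓ          = λ free → free-ℓ (free ∘ there)
      ; good-ℓ          = λ { (here refl) _ → free-ℓ free-i ; (there e∈) good → good-ℓ e∈ (good-old good) }
      ; good-c          = good-c′
      ; c≤2^r           = c≤2^r′
      ; balance         = balance′
      }
      where
      M′ = (i , j) ∷ M
      c′ = updateAt c j (const 0)

      c′-new : c′ j ≡ 0
      c′-new = updateAt-updates j c

      c′-old : ∀ {v} → v ≢ j → c′ v ≡ c v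
      c′-old v≢j = updateAt-minimal _ j c v≢j

      good-old : ∀ {v} → Good G M′ v → Good G M v
      good-old (i′ , i′~v , free) = i′ , i′~v , free ∘ there

      c≤T′ : ∀ v → c′ v ≤ T
      c≤T′ v with v Fin.≟ j
      ... | yes refl = ≤-trans (≤-reflexive c′-new) z≤n
      ... | no  v≢j  = ≤-trans (≤-reflexive (c′-old v≢j)) (c≤T v)

      good-c′ : ∀ {v} → v ∈ arrived τ → Good G M′ v → c′ v ≡ 0
      good-c′ v∈ good with arrive-case v∈
      ... | inj₁ v∈σ  = trans (c′-old (old≢j v∈σ)) (good-c v∈σ (good-old good))
      ... | inj₂ refl = c′-new

      c≤2^r′ : ∀ {u v d} → v ∈ arrived τ → Adj G u v → (u , d) ∈ M′ → Good G M′ d → c′ v ≤ 2 ^ r d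
      c≤2^r′ v∈ u~v e∈ good with arrive-case v∈
      ... | inj₂ refl = ≤-trans (≤-reflexive c′-new) z≤n
      -- Before the move `i` was free, so its earlier neighbour `v` was good and has label 0.
      c≤2^r′ v∈ u~v (here refl) good | inj₁ v∈σ =
        ≤-trans (≤-reflexive (trans (c′-old (old≢j v∈σ)) (good-c v∈σ (i , u~v , free-i)))) z≤n
      c≤2^r′ v∈ u~v (there e∈) good | inj₁ v∈σ =
        ≤-trans (≤-reflexive (c′-old (old≢j v∈σ))) (c≤2^r v∈σ u~v e∈ (good-old good))

      balance′ : total (λ d → 2 ^ r d) (map proj₂ M′) ≤ total (suc ∘ c′) (map proj₂ M′)
      balance′ = +-mono-≤
        -- The vertex `j` adds 2⁰ on the left and 1 + 0 on the right.
        (≤-reflexive (trans (cong (2 ^_) (unmatched-r j∉M)) (cong suc (sym c′-new))))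
        (≤-trans balance (≤-reflexive (sym (total-updateAt suc c j∉M))))

    -- Minimality of the cost enters twice: no direct path exists, so `j` is not good, and the new
    -- label 2^k is at most 2^(r d) for each good `d` whose partner is adjacent to `j`.
    via-invariant : ∀ x y i → Feasible 1 t G τ {j} (via x y i) →
                    (∀ q → Feasible 1 t G τ q → cost τ {j} (via x y i) ℤ.≤ cost τ {j} q) →
                    Invariant (augment τ {j} (via x y i)) (updateAt c j (const (2 ^ r y)))
    via-invariant x y i ((x~j , xy∈M , i~y , free-i) , _ , r≱t) cheapest = record
      { uniqueL         = ∉-∷ x∉ (∉-∷ i∉ (tail (Unique-resp-↭ ↭L uniqueL)))
      ; uniqueR         = ∉-∷ j∉ (∉-∷ y∉N (tail (Unique-resp-↭ ↭R uniqueR)))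
      ; matched-arrived = matched-arrived′
      ; unmatched-c     = λ v∉ → trans (c′-old (v∉ ∘ here)) (unmatched-c (v∉ ∘ there ∘ R-old))
      ; unmatched-r     = λ v∉ → trans (r′-old (v∉ ∘ there ∘ here)) (unmatched-r (v∉ ∘ there ∘ R-old))
      ; c≤T             = c≤T′
      ; free-ℓ          = λ free → trans (ℓ′-old (free ∘ here)) (free-ℓ (free-old free))
      ; good-ℓ          = good-ℓ′
      ; good-c          = good-c′
      ; c≤2^r           = c≤2^r′
      ; balance         = balance′
      }
      where
      N  = filter (λ e → ¬? (e ≟ₑ (x , y))) M
      M′ = (x , j) ∷ (i , y) ∷ N
      k  = r y
      c′ = updateAt c j (const (2 ^ k))
      r′ = updateAt r y suc
      ℓ′ = updateAt ℓ x suc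

      tail : ∀ {A : Set} {z : A} {zs} → Unique (z ∷ zs) → Unique zs
      tail (_ ∷ u) = u

      M↭ : M ↭ (x , y) ∷ N
      M↭ = filter-≢-↭ _≟ₑ_ (Unique.map⁻ uniqueR) xy∈M

      ↭L : map proj₁ M ↭ x ∷ map proj₁ N
      ↭L = ↭.map⁺ proj₁ M↭

      ↭R : map proj₂ M ↭ y ∷ map proj₂ N
      ↭R = ↭.map⁺ proj₂ M↭

      N⊆M : ∀ {e} → e ∈ N → e ∈ M
      N⊆M e∈ = ↭.∈-resp-↭ (↭-sym M↭) (there e∈)

      x∉N : x ∉ map proj₁ N
      x∉N = head∉ (Unique-resp-↭ ↭L uniqueL)

      y∉N : y ∉ map proj₂ N
      y∉N = head∉ (Unique-resp-↭ ↭R uniqueR)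

      i∉ : i ∉ map proj₁ N
      i∉ i∈ = free-i (↭.∈-resp-↭ (↭-sym ↭L) (there i∈))

      i≢x : i ≢ x
      i≢x refl = free-i (∈-map⁺ proj₁ xy∈M)

      x∉ : x ∉ i ∷ map proj₁ N
      x∉ (here x≡i) = i≢x (sym x≡i)
      x∉ (there x∈) = x∉N x∈

      j∉ : j ∉ y ∷ map proj₂ N
      j∉ j∈ = j∉M (↭.∈-resp-↭ (↭-sym ↭R) j∈)

      R-old : ∀ {v} → v ∈ map proj₂ M → v ∈ y ∷ map proj₂ N
      R-old = ↭.∈-resp-↭ ↭R

      c′-new : c′ j ≡ 2 ^ k
      c′-new = updateAt-updates j c

      c′-old : ∀ {v} → v ≢ j → c′ v ≡ c v
      c′-old v≢j = updateAt-minimal _ j c v≢j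

      r′-old : ∀ {v} → v ≢ y → r′ v ≡ r v
      r′-old v≢y = updateAt-minimal _ y r v≢y

      r′-y : r′ y ≡ suc k
      r′-y = updateAt-updates y r

      ℓ′-old : ∀ {u} → u ≢ x → ℓ′ u ≡ ℓ u
      ℓ′-old u≢x = updateAt-minimal _ x ℓ u≢x

      free-old : ∀ {u} → FreeL M′ u → FreeL M u
      free-old free u∈ with ↭.∈-resp-↭ ↭L u∈
      ... | here refl = free (here refl)
      ... | there u∈N = free (there (there u∈N))

      good-old : ∀ {v} → Good G M′ v → Good G M v
      good-old (i′ , i′~v , free) = i′ , i′~v , free-old free

      -- A direct path costs −1, less than the path chosen.
      ¬good-j : ¬ Good G M j
      ¬good-j (i′ , i′~j , free) with cheapest (direct i′) ((i′~j , free) , tt)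
      ... | ()

      matched-arrived′ : ∀ {v} → v ∈ map proj₂ M′ → v ∈ arrived τ
      matched-arrived′ (here refl) = ∈-++⁺ʳ (arrived σ) (here refl)
      matched-arrived′ (there v∈)  = ∈-arrive (matched-arrived (↭.∈-resp-↭ (↭-sym ↭R) v∈))

      k<t : k < t
      k<t = ≰⇒> r≱t

      c≤T′ : ∀ v → c′ v ≤ T
      c≤T′ v with v Fin.≟ j
      ... | yes refl = ≤-trans (≤-reflexive c′-new) (^-monoʳ-≤ 2 (<⇒≤ k<t))
      ... | no  v≢j  = ≤-trans (≤-reflexive (c′-old v≢j)) (c≤T v)

      N≢y : ∀ {u d} → (u , d) ∈ N → d ≢ y
      N≢y e∈ refl = y∉N (∈-map⁺ proj₂ e∈)

      good-ℓ′ : ∀ {u d} → (u , d) ∈ M′ → Good G M′ d → ℓ′ u ≡ 0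
      -- `x` has now spent its only reassignment, which is harmless because its new partner `j` is
      -- not good.
      good-ℓ′ (here refl)         good = contradiction (good-old good) ¬good-j
      good-ℓ′ (there (here refl)) good = trans (ℓ′-old i≢x) (free-ℓ free-i)
      good-ℓ′ (there (there e∈))  good =
        trans (ℓ′-old λ { refl → x∉N (∈-map⁺ proj₁ e∈) }) (good-ℓ (N⊆M e∈) (good-old good))

      good-c′ : ∀ {v} → v ∈ arrived τ → Good G M′ v → c′ v ≡ 0
      good-c′ v∈ good with arrive-case v∈
      ... | inj₁ v∈σ  = trans (c′-old (old≢j v∈σ)) (good-c v∈σ (good-old good))
      ... | inj₂ refl = contradiction (good-old good) ¬good-j

      2^k≤ : ∀ {u d} → Adj G u j → (u , d) ∈ M → Good G M d → 2 ^ k ≤ 2 ^ r d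
      2^k≤ {d = d} u~j ud∈M (i′ , i′~d , free) with t ≤? r d
      -- An exhausted `d` gives no path to compare with, but then r d ≥ t > k.
      ... | yes t≤r = ^-monoʳ-≤ 2 (≤-trans (<⇒≤ k<t) t≤r)
      ... | no  t≰r = ^-monoʳ-≤ 2 (ℤ.drop‿+≤+
        (cheapest (via _ d i′) (good-feasible u~j ud∈M i′~d free (≰⇒> t≰r))))

      c≤2^r′ : ∀ {u v d} → v ∈ arrived τ → Adj G u v → (u , d) ∈ M′ → Good G M′ d → c′ v ≤ 2 ^ r′ d
      c≤2^r′ v∈ u~v (here refl) good = contradiction (good-old good) ¬good-j
      -- `i` was free before the move: an earlier neighbour of it was good and has label 0, and `j`
      -- cannot be its neighbour.
      c≤2^r′ v∈ u~v (there (here refl)) good with arrive-case v∈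
      ... | inj₁ v∈σ  =
        ≤-trans (≤-reflexive (trans (c′-old (old≢j v∈σ)) (good-c v∈σ (i , u~v , free-i)))) z≤n
      ... | inj₂ refl = contradiction (i , u~v , free-i) ¬good-j
      c≤2^r′ v∈ u~v (there (there e∈)) good rewrite r′-old (N≢y e∈) with arrive-case v∈
      ... | inj₁ v∈σ  =
        ≤-trans (≤-reflexive (c′-old (old≢j v∈σ))) (c≤2^r v∈σ u~v (N⊆M e∈) (good-old good))
      ... | inj₂ refl = ≤-trans (≤-reflexive c′-new) (2^k≤ u~v (N⊆M e∈) (good-old good))

      balance′ : total (λ d → 2 ^ r′ d) (map proj₂ M′) ≤ total (suc ∘ c′) (map proj₂ M′)
      balance′ = begin
        2 ^ r′ j + (2 ^ r′ y + total (λ d → 2 ^ r′ d) ys)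
          ≡⟨ cong₂ _+_ (cong (2 ^_) (trans (r′-old (j∉ ∘ here)) (unmatched-r j∉M)))
                       (cong₂ _+_ (cong (2 ^_) r′-y) (total-updateAt (2 ^_) r y∉N)) ⟩
        -- The left side grows by 1 for `j` and by 2^k because the term of `y` doubles; this equals
        -- the term 1 + 2^k that `j` adds on the right.
        1 + (2 ^ suc k + total (λ d → 2 ^ r d) ys)
          ≡⟨ regroup (2 ^ k) _ ⟩
        suc (2 ^ k) + (2 ^ k + total (λ d → 2 ^ r d) ys)
          ≡⟨ cong (suc (2 ^ k) +_) (total-↭ (λ d → 2 ^ r d) ↭R) ⟨
        suc (2 ^ k) + total (λ d → 2 ^ r d) (map proj₂ M)
          ≤⟨ +-monoʳ-≤ (suc (2 ^ k)) balance ⟩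
        suc (2 ^ k) + total (suc ∘ c) (map proj₂ M)
          ≡⟨ cong (suc (2 ^ k) +_) (total-↭ (suc ∘ c) ↭R) ⟩
        suc (2 ^ k) + total (suc ∘ c) (y ∷ ys)
          ≡⟨ cong₂ _+_ (cong suc (sym c′-new)) (sym (total-updateAt suc c j∉)) ⟩
        suc (c′ j) + total (suc ∘ c′) (y ∷ ys) ∎
        where
        open ≤-Reasoning
        ys = map proj₂ N
        regroup : ∀ a b → 1 + (a + (a + 0) + b) ≡ suc a + (a + b)
        regroup = solve-∀

    outcome-invariant : ∀ {σ′} → Outcome 1 t G τ j σ′ → ∃ (Invariant σ′)
    outcome-invariant (stuck infeasible)                       = c , stuck-invariant infeasible
    outcome-invariant (augmented (direct i) (aug , _) _)       = _ , direct-invariant i aug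
    outcome-invariant (augmented (via x y i) feasible cheapest) = _ , via-invariant x y i feasible cheapest

  -- The invariant along the whole run.

  outcome-arrived : ∀ {σ τ : State m n} {j} → Outcome 1 t G τ j σ → arrived σ ≡ arrived τ
  outcome-arrived (stuck _)                   = refl
  outcome-arrived (augmented (direct _) _ _)  = refl
  outcome-arrived (augmented (via _ _ _) _ _) = refl

  -- Distinctness makes each vertex new when it arrives, as the single step demands; the equation
  -- for `arrived` will show that all of `R` has arrived.
  lcp-invariant : ∀ (rule : TieBreak) js {σ c} → Unique js → (∀ {j} → j ∈ js → j ∉ arrived σ) → Invariant σ c →
                  let σ′ = foldl (step 1 t rule G) σ js in
                  ∃ (Invariant σ′) × arrived σ′ ≡ arrived σ ++ js
  lcp-invariant rule []       {σ} {c} _        _   inv = (c , inv) , sym (++-identityʳ (arrived σ))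
  lcp-invariant rule (j ∷ js) {σ} u@(_ ∷ ujs) new inv
    with outcome-invariant inv (new (here refl)) (step-outcome 1 t rule G σ j)
       | outcome-arrived (step-outcome 1 t rule G σ j)
  ... | c′ , inv′ | arrived≡ with lcp-invariant rule js ujs new′ inv′
    where
    new′ : ∀ {k} → k ∈ js → k ∉ arrived (step 1 t rule G σ j)
    new′ k∈js k∈ with ∈-++⁻ (arrived σ) (subst (_ ∈_) arrived≡ k∈)
    ... | inj₁ k∈σ         = new (there k∈js) k∈σ
    ... | inj₂ (here refl) = head∉ u k∈js
  ... | inv″ , arrived″ =
    inv″ , trans arrived″ (trans (cong (_++ js) arrived≡) (++-assoc (arrived σ) (j ∷ []) js))

  -- Dual values on the final matching.

  -- The bound 2T − 1 appears as S + T with S = T − 1, which avoids truncated subtraction.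
  module _ {σ : State m n} {c : Vector ℕ n} (inv : Invariant σ c) (all-arrived : ∀ v → v ∈ arrived σ) where

    open Invariant inv

    private
      M = matching σ
      r = reassignedR σ
      S = pred T

      T≡ : suc S ≡ T
      T≡ = suc-pred T {{m^n≢0 2 t}}

      wL : Fin m × Fin n → ℕ
      wL (_ , d) = S + (if does (good? G M d) then 2 ^ r d else T)

      wR : Fin m × Fin n → ℕ
      wR (_ , d) = if does (good? G M d) then S + T else T ∸ c d

      module L = Charging Fin._≟_ proj₁ wL
      module R = Charging Fin._≟_ proj₂ wR

      -- An unmatched vertex has label `T`, so T - c v = 0 is also its dual value.
      c≤charge : ∀ v → ¬ Good G M v → T ∸ c v ≤ R.charge M v
      c≤charge v ¬good with DecMembership._∈?_ Fin._≟_ v (map proj₂ M)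
      ... | no  v∉ = ≤-trans (≤-reflexive (trans (cong (T ∸_) (unmatched-c v∉)) (n∸n≡0 T))) z≤n
      ... | yes v∈ with ∈-map⁻ proj₂ v∈
      ... | e , e∈ , refl = ≤-trans wR≥ (R.charge-≥ e∈)
        where
        wR≥ : T ∸ c v ≤ wR e
        wR≥ with good? G M v
        ... | yes good = contradiction good ¬good
        ... | no  _    = ≤-refl

      -- Once arrived, a good vertex has label 0, whereas an unmatched one has label T ≥ 1.
      good-matched : ∀ {v} → Good G M v → v ∈ map proj₂ M
      good-matched {v} good with DecMembership._∈?_ Fin._≟_ v (map proj₂ M)
      ... | yes v∈ = v∈
      ... | no  v∉ = contradiction
        (trans (sym (good-c (all-arrived v) good)) (unmatched-c v∉)) (<⇒≢ (m^n>0 2 t))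

      -- Dual feasibility. A good `v` pays alone. Otherwise `u` is matched, say to `d`: if `d` is
      -- not good, `u` pays alone; if it is, c v ≤ 2^(r d) closes the gap.
      edge-covered : ∀ {u v} → Adj G u v → S + T ≤ L.charge M u + R.charge M v
      edge-covered {u} {v} u~v with good? G M v
      ... | yes good with ∈-map⁻ proj₂ (good-matched good)
      ... | e , e∈ , refl = m≤n⇒m≤o+n _ (≤-trans wR≥ (R.charge-≥ e∈))
        where
        wR≥ : S + T ≤ wR e
        wR≥ with good? G M v
        ... | yes _    = ≤-refl
        ... | no ¬good = contradiction good ¬good
      edge-covered {u} {v} u~v | no ¬good-v with DecMembership._∈?_ Fin._≟_ u (map proj₁ M)
      ... | no  free = contradiction (u , u~v , free) ¬good-v
      ... | yes u∈ with ∈-map⁻ proj₁ u∈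
      ... | (_ , d) , e∈ , refl = ≤-trans wL≥ (+-mono-≤ (L.charge-≥ e∈) (c≤charge v ¬good-v))
        where
        wL≥ : S + T ≤ wL (u , d) + (T ∸ c v)
        wL≥ with good? G M d
        ... | no  _    = m≤m+n _ _
        ... | yes good = begin
          S + T                        ≤⟨ +-monoʳ-≤ S (m≤n+m∸n T (c v)) ⟩
          S + (c v + (T ∸ c v))        ≤⟨ +-monoʳ-≤ S (+-monoˡ-≤ _ (c≤2^r (all-arrived v) u~v e∈ good)) ⟩
          S + (2 ^ r d + (T ∸ c v))    ≡⟨ +-assoc S _ _ ⟨
          S + 2 ^ r d + (T ∸ c v)      ∎
          where open ≤-Reasoning

      -- An edge may cost more than 3T - 1, but its excess is at most 2^(r d) - (1 + c d), with
      -- equality if `d` is good.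
      weights : ∀ e → e ∈ M → wL e + wR e + suc (c (proj₂ e)) ≤ S + T + T + 2 ^ r (proj₂ e)
      weights (u , d) e∈ with good? G M d
      ... | yes good rewrite good-c (all-arrived d) good = ≤-reflexive (trans
        (regroup S (2 ^ r d) T) (cong (λ z → S + z + T + 2 ^ r d) T≡))
        where
        regroup : ∀ s a b → s + a + (s + b) + 1 ≡ s + suc s + b + a
        regroup = solve-∀
      ... | no  _ = begin
        S + T + (T ∸ c d) + suc (c d)    ≡⟨ regroup (S + T) _ _ ⟩
        S + T + (T ∸ c d + c d) + 1      ≡⟨ cong (λ z → S + T + z + 1) (m∸n+n≡m (c≤T d)) ⟩
        S + T + T + 1                    ≤⟨ +-monoʳ-≤ (S + T + T) (m^n>0 2 (r d)) ⟩
        S + T + T + 2 ^ r d              ∎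
        where
        open ≤-Reasoning
        regroup : ∀ a b k → a + b + suc k ≡ a + (b + k) + 1
        regroup = solve-∀

      -- Summed over the matching, the excesses of the edges are at most 0 by `balance`.
      total-weights : total wL M + total wR M ≤ length M ℕ.* (S + T + T)
      total-weights = +-cancelʳ-≤ (total (λ e → suc (c (proj₂ e))) M) _ _ (begin
        total wL M + total wR M + total (λ e → suc (c (proj₂ e))) M
          ≡⟨ cong (_+ total (λ e → suc (c (proj₂ e))) M) (total-+ wL wR M) ⟨
        total (λ e → wL e + wR e) M + total (λ e → suc (c (proj₂ e))) M
          ≡⟨ total-+ _ _ M ⟨
        total (λ e → wL e + wR e + suc (c (proj₂ e))) M
          ≤⟨ total-mono M (weights _) ⟩
        total (λ e → S + T + T + 2 ^ r (proj₂ e)) M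
          ≡⟨ total-+ _ _ M ⟩
        total (λ _ → S + T + T) M + total (λ e → 2 ^ r (proj₂ e)) M
          ≡⟨ cong₂ _+_ (total-const (S + T + T) M) (cong sum (map-∘ M)) ⟩
        length M ℕ.* (S + T + T) + total (λ d → 2 ^ r d) (map proj₂ M)
          ≤⟨ +-monoʳ-≤ (length M ℕ.* (S + T + T)) balance ⟩
        length M ℕ.* (S + T + T) + total (suc ∘ c) (map proj₂ M)
          ≡⟨ cong (length M ℕ.* (S + T + T) +_) (cong sum (map-∘ M)) ⟨
        length M ℕ.* (S + T + T) + total (λ e → suc (c (proj₂ e))) M ∎)
        where open ≤-Reasoning

    -- Weak duality: edges of `M*` share no endpoints, so the dual values they collect do not exceed
    -- the dual total.
    matching-bound : ∀ {M*} → IsMatching G M* → (2 ℕ.* T ∸ 1) ℕ.* length M* ≤ (3 ℕ.* T ∸ 1) ℕ.* length M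
    matching-bound {M*} (isMatching edges distinctL distinctR) = begin
      (2 ℕ.* T ∸ 1) ℕ.* length M*
        ≡⟨ cong (ℕ._* length M*) 2T∸1 ⟩
      (S + T) ℕ.* length M*
        ≡⟨ *-comm (S + T) (length M*) ⟩
      length M* ℕ.* (S + T)
        ≡⟨ total-const (S + T) M* ⟨
      total (λ _ → S + T) M*
        ≤⟨ total-mono M* (λ e∈ → edge-covered (All.lookup edges e∈)) ⟩
      total (λ e → L.charge M (proj₁ e) + R.charge M (proj₂ e)) M*
        ≡⟨ total-+ _ _ M* ⟩
      total (L.charge M ∘ proj₁) M* + total (R.charge M ∘ proj₂) M*
        ≡⟨ cong₂ _+_ (cong sum (map-∘ M*)) (cong sum (map-∘ M*)) ⟩
      total (L.charge M) (map proj₁ M*) + total (R.charge M) (map proj₂ M*)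
        ≤⟨ +-mono-≤ (L.total-charge M distinctL) (R.total-charge M distinctR) ⟩
      total wL M + total wR M
        ≤⟨ total-weights ⟩
      length M ℕ.* (S + T + T)
        ≡⟨ *-comm (length M) (S + T + T) ⟩
      (S + T + T) ℕ.* length M
        ≡⟨ cong (ℕ._* length M) 3T∸1 ⟨
      (3 ℕ.* T ∸ 1) ℕ.* length M ∎
      where
      open ≤-Reasoning
      2T∸1 : 2 ℕ.* T ∸ 1 ≡ S + T
      2T∸1 = trans (cong (λ z → z + (T + 0) ∸ 1) (sym T≡)) (cong (S +_) (+-identityʳ T))
      3T∸1 : 3 ℕ.* T ∸ 1 ≡ S + T + T
      3T∸1 = trans (cong (λ z → z + (T + (T + 0)) ∸ 1) (sym T≡))
        (trans (cong (λ z → S + (T + z)) (+-identityʳ T)) (sym (+-assoc S T T)))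

-- The competitive ratio.

module _ (t : ℕ) {m n} (G : BipartiteGraph m n) where

  open Analysis t G

  -- Since `π` is a permutation, the arrivals are distinct and exhaust `R`.
  lcp-matching-bound : ∀ (rule : TieBreak) (π : Permutation′ n) {M*} → IsMatching G M* →
    (2 ℕ.* 2 ^ t ∸ 1) ℕ.* length M* ≤ (3 ℕ.* 2 ^ t ∸ 1) ℕ.* length (lcp 1 t rule G π)
  lcp-matching-bound rule π =
    let (_ , inv) , arrived≡ = lcp-invariant rule arrivals distinct (λ _ ()) initial-invariant
    in matching-bound inv λ v → subst (v ∈_) (sym arrived≡) (all-arrive v)
    where
    arrivals = map (π ⟨$⟩ʳ_) (allFin n)

    distinct : Unique arrivals
    distinct = Unique.map⁺ (Injection.injective (↔⇒↣ π)) (Unique.allFin⁺ n)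

    all-arrive : ∀ v → v ∈ arrivals
    all-arrive v = subst (_∈ arrivals) (inverseʳ π) (∈-map⁺ (π ⟨$⟩ʳ_) (∈-allFin (π ⟨$⟩ˡ v)))

theorem14 : ∀ (t : ℕ) (rule : TieBreak) {m n : ℕ} (G : BipartiteGraph m n) (π : Permutation′ n) →
    fromℕ (length (lcp 1 t rule G π)) ≥ ratio t * fromℕ (ν G)
theorem14 t rule G π =
  let _ , isM , length≡ = IsMatchingNumber.attained (proj₂ (matchingNumber G)) in
  /-*-≤ (2 ℕ.* 2 ^ t ∸ 1) (3 ℕ.* 2 ^ t ∸ 1) {{3*2^t∸1≢0}} (ν G) (length (lcp 1 t rule G π))
    (subst (λ k → (2 ℕ.* 2 ^ t ∸ 1) ℕ.* k ≤ (3 ℕ.* 2 ^ t ∸ 1) ℕ.* length (lcp 1 t rule G π)) length≡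
      (lcp-matching-bound t G rule π isM))
  where
  3*2^t∸1≢0 : NonZero (3 ℕ.* 2 ^ t ∸ 1)
  3*2^t∸1≢0 = ℕ.>-nonZero (m<n⇒0<n∸m (≤-trans (s≤s (s≤s z≤n)) (*-monoʳ-≤ 3 (m^n>0 2 t))))
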